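{- Let $X=[n]$ be the disjoint union of sets $X_1,\dots,X_r$, with $|X_k|=n_k$ for $k\in[r]$. Let $A_1,\dots,A_m,B_1,\dots,B_m\subseteq X$ be such that $\mathcal{P}=\{(A_i,B_i)\mid i\in[m]\}$ is a skew Bollobás system. Then $$\sum_{i=1}^m \left(\prod_{k=1}^r \binom{|A_i\cap X_k|+|B_i\cap X_k|}{|A_i\cap X_k|}\right)^{ -1} \le \prod_{k=1}^r (1+n_k) \le \left(1+\frac{n}{r}\right)^r.$$
   Context: A family of pairs of sets $\mathcal{P}=\{(A_i,B_i)\mid i\in[m]\}$ is called a skew Bollobás system if (1) $A_i\cap B_i=\emptyset$ for every $i\in[m]$, and (2) $A_i\cap B_j\neq\emptyset$ whenever $i<j$. Here $[n]=\{1,\dots,n\}$. -}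

module Defs where

open import Data.Nat using (ℕ; zero; suc; NonZero)
open import Data.Nat.Combinatorics using (_C_)
open import Data.Fin using (Fin; zero; suc)
open import Data.Fin.Subset using (Subset; _∩_; ∣_∣; Empty; Nonempty)
open import Data.Integer using (+_)
open import Data.Rational using (ℚ; 0ℚ; 1ℚ; _+_; _*_; _/_)

sumℚ : ∀ {m} → (Fin m → ℚ) → ℚ
sumℚ {zero} f = 0ℚ
sumℚ {suc m} f = f zero + sumℚ (λ i → f (suc i))

prodℕ : ∀ {r} → (Fin r → ℕ) → ℕ
prodℕ {zero} f = 1
prodℕ {suc r} f = f zero Data.Nat.* prodℕ (λ i → f (suc i))
  where import Data.Nat

_^ℚ_ : ℚ → ℕ → ℚ
q ^ℚ zero = 1ℚ
q ^ℚ suc k = q * (q ^ℚ k)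

-- Reciprocal of a natural number as a rational (1/k); only ever applied
-- to positive numbers (products of binomial coefficients C(a+b,a) ≥ 1),
-- the value at 0 is an irrelevant convention.
recipℕ : ℕ → ℚ
recipℕ zero = 0ℚ
recipℕ (suc k) = + 1 / suc k

SkewBollobas : ∀ {n m} → (A B : Fin m → Subset n) → Set
SkewBollobas {n} {m} A B =
  (∀ i → Empty (A i ∩ B i)) ×
  (∀ i j → i Data.Fin.< j → Nonempty (A i ∩ B j))
  where open import Data.Product using (_×_)
        import Data.Fin

weight : ∀ {n r} → (X : Fin r → Subset n) → (A B : Subset n) → ℕ
weight X A B = prodℕ (λ k → (∣ A ∩ X k ∣ Data.Nat.+ ∣ B ∩ X k ∣) C ∣ A ∩ X k ∣)
  where import Data.Nat

-- Multiplying by ∏ₖ nₖ!, the i-th term becomes the number of tuples of linear orders of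
-- the blocks Xₖ in which Aᵢ ∩ Xₖ precedes Bᵢ ∩ Xₖ, and the bound becomes ∏ₖ (nₖ + 1)!.
-- This integer inequality holds for every ground set L and every subfamily that is skew
-- on L, by induction on |L|: pick a block k meeting L, of size s, and sum over the last
-- element y of the order on L ∩ Xₖ.  A pair with y ∉ Aᵢ is counted again for L - y, on
-- which the subfamily stays skew; a pair with y ∈ Aᵢ survives only if Bᵢ misses L ∩ Xₖ,
-- and those pairs stay skew on L with the whole block removed, where they are counted
-- (s - 1)! times fewer.  Hence the sum is at most s (s! + (s - 1)!) R = (s + 1)! R, where
-- R accounts for the other blocks.  The second inequality is AM-GM for the numbers
-- 1 + nₖ, whose sum is at most r + n.
module Submission where

module Counting where
  open import Data.Bool using (Bool; true; false; _∧_; not)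
  open import Data.Bool.Properties using (∧-identityʳ; ∧-zeroʳ)
  open import Data.Empty using (⊥)
  open import Data.Fin as Fin using (Fin; zero; suc)
  import Data.Fin.Properties as Finₚ
  open import Data.Nat using (ℕ; zero; suc; _+_; _*_; _≤_; z≤n; s≤s; _≡ᵇ_)
  open import Data.Nat.Properties
  open import Data.Product using (_×_; _,_)
  open import Function using (_∘_)
  open import Relation.Binary.PropositionalEquality
  open import Relation.Nullary using (does)
  open import Algebra.Properties.Semiring.Sum +-*-semiring
    using (sum; sum-syntax; sum-cong-≗; ∑-distrib-+; ∑-comm; *-distribʳ-sum; *-distribˡ-sum)
  import Algebra.Properties.CommutativeSemigroup as CommSemigroupProperties
  module +-CS = CommSemigroupProperties +-commutativeSemigroup
  module *-CS = CommSemigroupProperties *-commutativeSemigroup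

  cong₃ : ∀ {A B C D : Set} (f : A → B → C → D) {a a′ b b′ c c′} →
    a ≡ a′ → b ≡ b′ → c ≡ c′ → f a b c ≡ f a′ b′ c′
  cong₃ f refl refl refl = refl

  ∧-true : ∀ {a b} → a ∧ b ≡ true → a ≡ true × b ≡ true
  ∧-true {true} b≡true = refl , b≡true

  ≡ᵇ0⇒≡0 : ∀ {c} → (c ≡ᵇ 0) ≡ true → c ≡ 0
  ≡ᵇ0⇒≡0 {zero} _ = refl

  χ : Bool → ℕ
  χ true = 1
  χ false = 0

  χ-∧ : ∀ a b → χ (a ∧ b) ≡ χ a * χ b
  χ-∧ true b = sym (+-identityʳ (χ b))
  χ-∧ false b = refl

  count : ∀ {n} → (Fin n → Bool) → ℕ
  count P = ∑[ y < _ ] χ (P y)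

  _without_ : ∀ {n} → (Fin n → Bool) → Fin n → Fin n → Bool
  (P without x) y = P y ∧ not (does (y Fin.≟ x))

  sum-mono-≤ : ∀ {n} {f g : Fin n → ℕ} → (∀ y → f y ≤ g y) → sum f ≤ sum g
  sum-mono-≤ {zero} f≤g = z≤n
  sum-mono-≤ {suc n} f≤g = +-mono-≤ (f≤g zero) (sum-mono-≤ (f≤g ∘ suc))

  ∑-χ* : ∀ {n} (P : Fin n → Bool) c → ∑[ y < n ] (χ (P y) * c) ≡ count P * c
  ∑-χ* P c = sym (*-distribʳ-sum c (χ ∘ P))

  ∑-*-∑-comm : ∀ {m n} (a : Fin m → ℕ) (b : Fin n → ℕ) (f : Fin m → Fin n → ℕ) →
    ∑[ i < m ] (a i * ∑[ y < n ] (b y * f i y)) ≡ ∑[ y < n ] (b y * ∑[ i < m ] (a i * f i y))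
  ∑-*-∑-comm {m} {n} a b f = begin
    ∑[ i < m ] (a i * ∑[ y < n ] (b y * f i y))
      ≡⟨ sum-cong-≗ (λ i → *-distribˡ-sum (a i) (λ y → b y * f i y)) ⟩
    ∑[ i < m ] ∑[ y < n ] (a i * (b y * f i y))
      ≡⟨ ∑-comm (λ i y → a i * (b y * f i y)) ⟩
    ∑[ y < n ] ∑[ i < m ] (a i * (b y * f i y))
      ≡⟨ sum-cong-≗ (λ y → sum-cong-≗ (λ i → *-CS.x∙yz≈y∙xz (a i) (b y) (f i y))) ⟩
    ∑[ y < n ] ∑[ i < m ] (b y * (a i * f i y))
      ≡⟨ sum-cong-≗ (λ y → sym (*-distribˡ-sum (b y) (λ i → a i * f i y))) ⟩
    ∑[ y < n ] (b y * ∑[ i < m ] (a i * f i y)) ∎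
    where open ≡-Reasoning

  count-cong : ∀ {n} {P Q : Fin n → Bool} → (∀ y → P y ≡ Q y) → count P ≡ count Q
  count-cong P≗Q = sum-cong-≗ (cong χ ∘ P≗Q)

  count-mono : ∀ {n} {P Q : Fin n → Bool} → (∀ y → P y ≡ true → Q y ≡ true) → count P ≤ count Q
  count-mono P⊆Q = sum-mono-≤ (λ y → χ-mono (P⊆Q y))
    where
    χ-mono : ∀ {a b} → (a ≡ true → b ≡ true) → χ a ≤ χ b
    χ-mono {false} _ = z≤n
    χ-mono {true} a⇒b rewrite a⇒b refl = ≤-refl

  count-none : ∀ {n} (P : Fin n → Bool) → (∀ y → P y ≡ false) → count P ≡ 0
  count-none {n} P none = trans (count-cong none) (zeros n)
    where
    zeros : ∀ n → count {n} (λ _ → false) ≡ 0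
    zeros zero = refl
    zeros (suc n) = zeros n

  count-all : ∀ n → count {n} (λ _ → true) ≡ n
  count-all zero = refl
  count-all (suc n) = cong suc (count-all n)

  count-remove : ∀ {n} (P : Fin n → Bool) x → count P ≡ χ (P x) + count (P without x)
  count-remove {suc n} P zero = cong (χ (P zero) +_) (sym (begin
    χ (P zero ∧ false) + count (λ y → P (suc y) ∧ true)
      ≡⟨ cong (λ b → χ b + count (λ y → P (suc y) ∧ true)) (∧-zeroʳ (P zero)) ⟩
    count (λ y → P (suc y) ∧ true)
      ≡⟨ count-cong (∧-identityʳ ∘ P ∘ suc) ⟩
    count (P ∘ suc) ∎))
    where open ≡-Reasoning
  count-remove {suc n} P (suc x) = begin
    χ (P zero) + count (P ∘ suc)
      ≡⟨ cong (χ (P zero) +_) (count-remove (P ∘ suc) x) ⟩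
    χ (P zero) + (χ (P (suc x)) + rest)
      ≡⟨ +-CS.x∙yz≈y∙xz (χ (P zero)) (χ (P (suc x))) rest ⟩
    χ (P (suc x)) + (χ (P zero) + rest)
      ≡⟨ cong (λ b → χ (P (suc x)) + (χ b + rest)) (sym (∧-identityʳ (P zero))) ⟩
    χ (P (suc x)) + count (P without suc x) ∎
    where
    open ≡-Reasoning
    rest = count ((P ∘ suc) without x)

  count-member : ∀ {n} (P : Fin n → Bool) {x} → P x ≡ true → count P ≡ suc (count (P without x))
  count-member P {x} Px = trans (count-remove P x) (cong (λ b → χ b + count (P without x)) Px)

  count≡0⇒∉ : ∀ {n} (P : Fin n → Bool) {x} → count P ≡ 0 → P x ≡ true → ⊥
  count≡0⇒∉ P c≡0 Px with () ← trans (sym (count-member P Px)) c≡0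

  count≤1 : ∀ {n} (P : Fin n → Bool) → (∀ x y → P x ≡ true → P y ≡ true → x ≡ y) → count P ≤ 1
  count≤1 {zero} P unique = z≤n
  count≤1 {suc n} P unique with P zero in P0
  ... | true = s≤s (≤-reflexive (count-none (P ∘ suc) rest))
    where
    rest : ∀ y → P (suc y) ≡ false
    rest y with P (suc y) in Py
    ... | true with () ← unique zero (suc y) P0 Py
    ... | false = refl
  ... | false = count≤1 (P ∘ suc) (λ x y Px Py → Finₚ.suc-injective (unique (suc x) (suc y) Px Py))

  χ-classes : ∀ y p q → (y ≡ true → p ≡ true → q ≡ false) → (g : Bool → Bool → ℕ) →
    χ y * g p q ≡
    χ (p ∧ y) * g true false + χ (q ∧ y) * g false true + χ (y ∧ not p ∧ not q) * g false false
  χ-classes false false false _ g = refl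
  χ-classes false false true _ g = refl
  χ-classes false true false _ g = refl
  χ-classes false true true _ g = refl
  χ-classes true false false _ g = refl
  χ-classes true false true _ g = sym (+-identityʳ _)
  χ-classes true true false _ g = sym (trans (+-identityʳ _) (+-identityʳ _))
  χ-classes true true true disjoint g with () ← disjoint refl refl

  ∑-χ-classes : ∀ {n} (Y P Q : Fin n → Bool) → (∀ y → Y y ≡ true → P y ≡ true → Q y ≡ false) →
    (g : Bool → Bool → ℕ) →
    ∑[ y < n ] (χ (Y y) * g (P y) (Q y)) ≡
    count (λ y → P y ∧ Y y) * g true false + count (λ y → Q y ∧ Y y) * g false true
      + count (λ y → Y y ∧ not (P y) ∧ not (Q y)) * g false false
  ∑-χ-classes Y P Q disjoint g = begin
    ∑[ y < _ ] (χ (Y y) * g (P y) (Q y))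
      ≡⟨ sum-cong-≗ (λ y → χ-classes (Y y) (P y) (Q y) (disjoint y) g) ⟩
    ∑[ y < _ ] (tf y + ft y + ff y)
      ≡⟨ trans (∑-distrib-+ (λ y → tf y + ft y) ff) (cong (_+ sum ff) (∑-distrib-+ tf ft)) ⟩
    sum tf + sum ft + sum ff
      ≡⟨ cong₂ _+_ (cong₂ _+_ (∑-χ* (λ y → P y ∧ Y y) _) (∑-χ* (λ y → Q y ∧ Y y) _))
                   (∑-χ* (λ y → Y y ∧ not (P y) ∧ not (Q y)) _) ⟩
    count (λ y → P y ∧ Y y) * g true false + count (λ y → Q y ∧ Y y) * g false true
      + count (λ y → Y y ∧ not (P y) ∧ not (Q y)) * g false false ∎
    where
    open ≡-Reasoning
    tf = λ y → χ (P y ∧ Y y) * g true false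
    ft = λ y → χ (Q y ∧ Y y) * g false true
    ff = λ y → χ (Y y ∧ not (P y) ∧ not (Q y)) * g false false

  count-classes : ∀ {n} (Y P Q : Fin n → Bool) → (∀ y → Y y ≡ true → P y ≡ true → Q y ≡ false) →
    count Y ≡ count (λ y → P y ∧ Y y) + count (λ y → Q y ∧ Y y) + count (λ y → Y y ∧ not (P y) ∧ not (Q y))
  count-classes Y P Q disjoint =
    trans (sum-cong-≗ (λ y → sym (*-identityʳ (χ (Y y)))))
      (trans (∑-χ-classes Y P Q disjoint (λ _ _ → 1))
        (cong₂ _+_ (cong₂ _+_ (*-identityʳ (count (λ y → P y ∧ Y y))) (*-identityʳ (count (λ y → Q y ∧ Y y))))
                   (*-identityʳ (count (λ y → Y y ∧ not (P y) ∧ not (Q y))))))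

module LinearOrders where
  open import Data.Nat using (ℕ; zero; suc; _+_; _*_; _∸_; _≤_; _<_; s≤s; _!; _≡ᵇ_)
  open import Data.Nat.Combinatorics using (_C_; nCn≡1; k![n∸k]!∣n!)
  open import Data.Nat.Combinatorics.Specification using (nCk≡n!/k![n-k]!)
  open import Data.Nat.Divisibility using (_∣_)
  open import Data.Nat.DivMod using (_/_; m/n*n≡m)
  open import Data.Nat.Properties
  open import Data.Sum using (inj₁; inj₂)
  open import Relation.Binary.PropositionalEquality
  open import Algebra.Properties.CommutativeSemigroup *-commutativeSemigroup using (x∙yz≈y∙xz; xy∙z≈y∙xz)
  open Counting using (χ)

  [a+b]Ca*a!b!≡[a+b]! : ∀ a b → ((a + b) C a) * (a ! * b !) ≡ (a + b) !
  [a+b]Ca*a!b!≡[a+b]! a b = begin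
    ((a + b) C a) * (a ! * b !)
      ≡⟨ cong (_* (a ! * b !)) (nCk≡n!/k![n-k]! (m≤m+n a b)) ⟩
    ((a + b) ! / (a ! * (a + b ∸ a) !)) {{a !* (a + b ∸ a) !≢0}} * (a ! * b !)
      ≡⟨ cong (λ c → ((a + b) ! / (a ! * c !)) {{a !* c !≢0}} * (a ! * b !)) (m+n∸m≡n a b) ⟩
    ((a + b) ! / (a ! * b !)) {{a !* b !≢0}} * (a ! * b !)
      ≡⟨ m/n*n≡m {{a !* b !≢0}}
           (subst (λ c → a ! * c ! ∣ (a + b) !) (m+n∸m≡n a b) (k![n∸k]!∣n! (m≤m+n a b))) ⟩
    (a + b) ! ∎
    where open ≡-Reasoning

  [1+b]*[a+1+b]Ca≡[a+1+b]*[a+b]Ca : ∀ a b → suc b * ((a + suc b) C a) ≡ (a + suc b) * ((a + b) C a)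
  [1+b]*[a+1+b]Ca≡[a+1+b]*[a+b]Ca a b = *-cancelʳ-≡ _ _ (a ! * b !) {{a !* b !≢0}} (begin
    suc b * c′ * (a ! * b !)              ≡⟨ *-assoc (suc b) c′ (a ! * b !) ⟩
    suc b * (c′ * (a ! * b !))            ≡⟨ x∙yz≈y∙xz (suc b) c′ (a ! * b !) ⟩
    c′ * (suc b * (a ! * b !))            ≡⟨ cong (c′ *_) (x∙yz≈y∙xz (suc b) (a !) (b !)) ⟩
    c′ * (a ! * suc b !)                  ≡⟨ [a+b]Ca*a!b!≡[a+b]! a (suc b) ⟩
    (a + suc b) !                         ≡⟨ cong _! (+-suc a b) ⟩
    suc (a + b) * (a + b) !               ≡⟨ cong₂ _*_ (sym (+-suc a b)) (sym ([a+b]Ca*a!b!≡[a+b]! a b)) ⟩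
    (a + suc b) * (c * (a ! * b !))       ≡⟨ sym (*-assoc (a + suc b) c (a ! * b !)) ⟩
    (a + suc b) * c * (a ! * b !)         ∎)
    where
    open ≡-Reasoning
    c = (a + b) C a
    c′ = (a + suc b) C a

  -- Linear orders of an s-set in which a given a-subset precedes a disjoint b-subset,
  -- counted by their last element; orders 0 a b is junk unless a = b = 0.
  orders : ℕ → ℕ → ℕ → ℕ
  orders zero a b = 1
  orders (suc s) a b =
    a * (χ (b ≡ᵇ 0) * orders s (a ∸ 1) b) + b * orders s a (b ∸ 1) + (suc s ∸ a ∸ b) * orders s a b

  orders-unfold : ∀ {s} → 0 < s → ∀ a b → orders s a b ≡
    a * (χ (b ≡ᵇ 0) * orders (s ∸ 1) (a ∸ 1) b) + b * orders (s ∸ 1) a (b ∸ 1) + (s ∸ a ∸ b) * orders (s ∸ 1) a b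
  orders-unfold {suc s} _ a b = refl

  orders*[a+b]Ca≡s! : ∀ s a b → a + b ≤ s → orders s a b * ((a + b) C a) ≡ s !

  orders[s,a,0]≡s! : ∀ s a → a ≤ s → orders s a 0 ≡ s !
  orders[s,a,0]≡s! s a a≤s = begin
    orders s a 0                    ≡⟨ sym (*-identityʳ _) ⟩
    orders s a 0 * 1                ≡⟨ cong (orders s a 0 *_) (sym (trans (cong (_C a) (+-identityʳ a)) (nCn≡1 a))) ⟩
    orders s a 0 * ((a + 0) C a)    ≡⟨ orders*[a+b]Ca≡s! s a 0 (subst (_≤ s) (sym (+-identityʳ a)) a≤s) ⟩
    s !                             ∎
    where open ≡-Reasoning

  orders*[a+b]Ca≡s! zero zero zero _ = refl
  orders*[a+b]Ca≡s! (suc s) a b a+b≤1+s = begin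
    (last-in-A∪B + (suc s ∸ a ∸ b) * orders s a b) * ((a + b) C a)
      ≡⟨ *-distribʳ-+ ((a + b) C a) last-in-A∪B _ ⟩
    last-in-A∪B * ((a + b) C a) + (suc s ∸ a ∸ b) * orders s a b * ((a + b) C a)
      ≡⟨ cong₂ _+_ (last-in-A∪B-term a b a+b≤1+s) (trans (*-assoc (suc s ∸ a ∸ b) _ _) last-outside-term) ⟩
    (a + b) * s ! + (suc s ∸ (a + b)) * s !
      ≡⟨ sym (*-distribʳ-+ (s !) (a + b) _) ⟩
    (a + b + (suc s ∸ (a + b))) * s !
      ≡⟨ cong (_* s !) (m+[n∸m]≡n a+b≤1+s) ⟩
    suc s * s ! ∎
    where
    open ≡-Reasoning
    IH = orders*[a+b]Ca≡s! s
    last-in-A∪B = a * (χ (b ≡ᵇ 0) * orders s (a ∸ 1) b) + b * orders s a (b ∸ 1)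

    last-in-A∪B-term : ∀ a b → a + b ≤ suc s →
      (a * (χ (b ≡ᵇ 0) * orders s (a ∸ 1) b) + b * orders s a (b ∸ 1)) * ((a + b) C a) ≡ (a + b) * s !
    last-in-A∪B-term zero zero _ = refl
    last-in-A∪B-term (suc a) zero (s≤s a+0≤s) = begin
      (suc a * (1 * orders s a 0) + 0) * ((suc a + 0) C suc a)
        ≡⟨ cong₂ _*_ (+-identityʳ (suc a * (1 * orders s a 0)))
                     (trans (cong (_C suc a) (+-identityʳ (suc a))) (nCn≡1 (suc a))) ⟩
      suc a * (1 * orders s a 0) * 1
        ≡⟨ trans (*-identityʳ _) (cong (suc a *_) (*-identityˡ _)) ⟩
      suc a * orders s a 0
        ≡⟨ cong (suc a *_) (orders[s,a,0]≡s! s a (subst (_≤ s) (+-identityʳ a) a+0≤s)) ⟩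
      suc a * s !
        ≡⟨ cong (_* s !) (sym (+-identityʳ (suc a))) ⟩
      (suc a + 0) * s ! ∎
    last-in-A∪B-term a (suc b) a+1+b≤1+s = begin
      (a * 0 + suc b * orders s a b) * ((a + suc b) C a)
        ≡⟨ cong (λ x → (x + suc b * orders s a b) * ((a + suc b) C a)) (*-zeroʳ a) ⟩
      suc b * orders s a b * ((a + suc b) C a)
        ≡⟨ xy∙z≈y∙xz (suc b) (orders s a b) ((a + suc b) C a) ⟩
      orders s a b * (suc b * ((a + suc b) C a))
        ≡⟨ cong (orders s a b *_) ([1+b]*[a+1+b]Ca≡[a+1+b]*[a+b]Ca a b) ⟩
      orders s a b * ((a + suc b) * ((a + b) C a))
        ≡⟨ x∙yz≈y∙xz (orders s a b) (a + suc b) ((a + b) C a) ⟩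
      (a + suc b) * (orders s a b * ((a + b) C a))
        ≡⟨ cong ((a + suc b) *_) (IH a b (≤-pred (subst (_≤ suc s) (+-suc a b) a+1+b≤1+s))) ⟩
      (a + suc b) * s ! ∎

    last-outside-term : (suc s ∸ a ∸ b) * (orders s a b * ((a + b) C a)) ≡ (suc s ∸ (a + b)) * s !
    last-outside-term rewrite ∸-+-assoc (suc s) a b with m≤n⇒m<n∨m≡n a+b≤1+s
    ... | inj₁ a+b<1+s = cong ((suc s ∸ (a + b)) *_) (IH a b (≤-pred a+b<1+s))
    ... | inj₂ a+b≡1+s rewrite a+b≡1+s | n∸n≡0 s = refl

module Products where
  open import Data.Fin as Fin using (Fin; zero; suc)
  open import Data.Nat using (ℕ; zero; suc; _+_; _*_; NonZero)
  open import Data.Nat.Properties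
  open import Data.Vec.Functional using (updateAt)
  open import Data.Vec.Functional.Properties using (updateAt-updates; updateAt-minimal)
  open import Function using (_∘_)
  open import Relation.Binary.PropositionalEquality
  open import Relation.Nullary using (yes; no)
  open import Algebra.Properties.CommutativeSemigroup *-commutativeSemigroup using (x∙yz≈y∙xz; interchange)
  open import Defs using (prodℕ)

  prodℕ-cong : ∀ {r} {f g : Fin r → ℕ} → (∀ k → f k ≡ g k) → prodℕ f ≡ prodℕ g
  prodℕ-cong {zero} f≗g = refl
  prodℕ-cong {suc r} f≗g = cong₂ _*_ (f≗g zero) (prodℕ-cong (f≗g ∘ suc))

  prodℕ-1 : ∀ r → prodℕ {r} (λ _ → 1) ≡ 1
  prodℕ-1 zero = refl
  prodℕ-1 (suc r) = cong (_+ 0) (prodℕ-1 r)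

  prodℕ-*-distrib : ∀ {r} (f g : Fin r → ℕ) → prodℕ (λ k → f k * g k) ≡ prodℕ f * prodℕ g
  prodℕ-*-distrib {zero} f g = refl
  prodℕ-*-distrib {suc r} f g = trans (cong (f zero * g zero *_) (prodℕ-*-distrib (f ∘ suc) (g ∘ suc)))
    (interchange (f zero) (g zero) (prodℕ (f ∘ suc)) (prodℕ (g ∘ suc)))

  prodℕ-nonZero : ∀ {r} (f : Fin r → ℕ) → (∀ k → NonZero (f k)) → NonZero (prodℕ f)
  prodℕ-nonZero {zero} f f≢0 = _
  prodℕ-nonZero {suc r} f f≢0 = m*n≢0 (f zero) _ {{f≢0 zero}} {{prodℕ-nonZero (f ∘ suc) (f≢0 ∘ suc)}}

  prodℕ-updateAt : ∀ {r} (f : Fin r → ℕ) k → prodℕ f ≡ f k * prodℕ (updateAt f k (λ _ → 1))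
  prodℕ-updateAt {suc r} f zero = cong (f zero *_) (sym (+-identityʳ (prodℕ (f ∘ suc))))
  prodℕ-updateAt {suc r} f (suc k) = trans (cong (f zero *_) (prodℕ-updateAt (f ∘ suc) k))
    (x∙yz≈y∙xz (f zero) (f (suc k)) _)

  prodℕ-agreeOff : ∀ {r} (f g : Fin r → ℕ) k → (∀ l → l ≢ k → g l ≡ f l) →
    prodℕ g ≡ g k * prodℕ (updateAt f k (λ _ → 1))
  prodℕ-agreeOff f g k g≡f = trans (prodℕ-updateAt g k) (cong (g k *_) (prodℕ-cong same))
    where
    same : ∀ l → updateAt g k (λ _ → 1) l ≡ updateAt f k (λ _ → 1) l
    same l with l Fin.≟ k
    ... | yes refl = trans (updateAt-updates l g) (sym (updateAt-updates l f))
    ... | no l≢k = trans (updateAt-minimal l k g l≢k) (trans (g≡f l l≢k) (sym (updateAt-minimal l k f l≢k)))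

module AmGm where
  open import Data.Fin using (Fin; zero; suc)
  open import Data.Nat using (ℕ; zero; suc; _+_; _*_; _^_; _≤_; NonZero)
  open import Data.Nat.Properties
  open import Data.Nat.Tactic.RingSolver using (solve-∀)
  open import Data.Product using (_,_)
  open import Data.Sum using (inj₁; inj₂)
  open import Function using (_∘_)
  open import Relation.Binary.PropositionalEquality
  open import Algebra.Properties.CommutativeSemigroup *-commutativeSemigroup using (interchange)
  open import Algebra.Properties.Semiring.Sum +-*-semiring using (sum-syntax)
  open import Defs using (prodℕ)

  2xy≤x²+y² : ∀ x y → 2 * (x * y) ≤ x * x + y * y
  2xy≤x²+y² x y with ≤-total x y
  ... | inj₁ x≤y with t , refl ← m≤n⇒∃[o]m+o≡n x≤y = subst (2 * (x * (x + t)) ≤_) (sym (square x t)) (m≤m+n _ _)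
    where
    square : ∀ x t → x * x + (x + t) * (x + t) ≡ 2 * (x * (x + t)) + t * t
    square = solve-∀
  ... | inj₂ y≤x with t , refl ← m≤n⇒∃[o]m+o≡n y≤x = subst (2 * ((y + t) * y) ≤_) (sym (square y t)) (m≤m+n _ _)
    where
    square : ∀ y t → (y + t) * (y + t) + y * y ≡ 2 * ((y + t) * y) + t * t
    square = solve-∀

  [1+n]*e*dⁿ≤e¹⁺ⁿ+n*d¹⁺ⁿ : ∀ n e d → suc n * e * d ^ n ≤ e ^ suc n + n * d ^ suc n
  [1+n]*e*dⁿ≤e¹⁺ⁿ+n*d¹⁺ⁿ zero e d = ≤-reflexive (1*e*1≡e*1+0 e)
    where
    1*e*1≡e*1+0 : ∀ e → 1 * e * 1 ≡ e * 1 + 0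
    1*e*1≡e*1+0 = solve-∀
  [1+n]*e*dⁿ≤e¹⁺ⁿ+n*d¹⁺ⁿ (suc n) e d = +-cancelʳ-≤ (n * e * (d * Q)) _ _ (begin
    suc (suc n) * e * (d * Q) + n * e * (d * Q)     ≡⟨ regroup₁ n e d Q ⟩
    2 * (e * d) * (suc n * Q)                       ≤⟨ *-monoˡ-≤ (suc n * Q) (2xy≤x²+y² e d) ⟩
    (e * e + d * d) * (suc n * Q)                   ≡⟨ regroup₂ n e d Q ⟩
    e * (suc n * e * Q) + suc n * (d * (d * Q))     ≤⟨ +-monoˡ-≤ _ (*-monoʳ-≤ e ([1+n]*e*dⁿ≤e¹⁺ⁿ+n*d¹⁺ⁿ n e d)) ⟩
    e * (P + n * (d * Q)) + suc n * (d * (d * Q))   ≡⟨ regroup₃ n e d Q P ⟩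
    e * P + suc n * (d * (d * Q)) + n * e * (d * Q) ∎)
    where
    open ≤-Reasoning
    Q = d ^ n
    P = e ^ suc n
    regroup₁ : ∀ n e d Q → suc (suc n) * e * (d * Q) + n * e * (d * Q) ≡ 2 * (e * d) * (suc n * Q)
    regroup₁ = solve-∀
    regroup₂ : ∀ n e d Q → (e * e + d * d) * (suc n * Q) ≡ e * (suc n * e * Q) + suc n * (d * (d * Q))
    regroup₂ = solve-∀
    regroup₃ : ∀ n e d Q P →
      e * (P + n * (d * Q)) + suc n * (d * (d * Q)) ≡ e * P + suc n * (d * (d * Q)) + n * e * (d * Q)
    regroup₃ = solve-∀

  ^-distribʳ-* : ∀ m n o → (m * n) ^ o ≡ m ^ o * n ^ o
  ^-distribʳ-* m n zero = refl
  ^-distribʳ-* m n (suc o) = trans (cong (m * n *_) (^-distribʳ-* m n o)) (interchange m n (m ^ o) (n ^ o))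

  -- Passing from r to 1 + r, the new term y is compared with the old mean S/r through
  -- the weighted inequality applied to e = r (y + S) and d = (1 + r) S.
  am-gm-step : ∀ r .{{_ : NonZero r}} y S Π → r ^ r * Π ≤ S ^ r → suc r ^ suc r * (y * Π) ≤ (y + S) ^ suc r
  am-gm-step r y S Π rʳΠ≤Sʳ = *-cancelˡ-≤ (r ^ suc r) {{m^n≢0 r (suc r)}} (begin
    r ^ suc r * (suc r ^ suc r * (y * Π))   ≡⟨ sym (regroup₁ r (r ^ r) (suc r ^ r) y Π) ⟩
    z * (suc r ^ r * (r ^ r * Π))           ≤⟨ *-monoʳ-≤ z (*-monoʳ-≤ (suc r ^ r) rʳΠ≤Sʳ) ⟩
    z * (suc r ^ r * S ^ r)                 ≡⟨ cong (z *_) (sym (^-distribʳ-* (suc r) S r)) ⟩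
    z * d ^ r                               ≤⟨ +-cancelˡ-≤ (r * d ^ suc r) _ _ weighted ⟩
    e ^ suc r                               ≡⟨ ^-distribʳ-* r (y + S) (suc r) ⟩
    r ^ suc r * (y + S) ^ suc r             ∎)
    where
    open ≤-Reasoning
    e = r * (y + S)
    d = suc r * S
    z = r * suc r * y
    regroup₁ : ∀ r a b y Π → r * suc r * y * (b * (a * Π)) ≡ r * a * (suc r * b * (y * Π))
    regroup₁ = solve-∀
    regroup₂ : ∀ r y S D → suc r * (r * (y + S)) * D ≡ r * (suc r * S * D) + r * suc r * y * D
    regroup₂ = solve-∀
    weighted : r * d ^ suc r + z * d ^ r ≤ r * d ^ suc r + e ^ suc r
    weighted = subst₂ _≤_ (regroup₂ r y S (d ^ r)) (+-comm _ (r * d ^ suc r)) ([1+n]*e*dⁿ≤e¹⁺ⁿ+n*d¹⁺ⁿ r e d)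

  am-gm : ∀ r (x : Fin r → ℕ) → r ^ r * prodℕ x ≤ (∑[ k < r ] x k) ^ r
  am-gm zero x = ≤-refl
  am-gm (suc zero) x = ≤-reflexive (1*[y*1]≡[y+0]*1 (x zero))
    where
    1*[y*1]≡[y+0]*1 : ∀ y → 1 * (y * 1) ≡ (y + 0) * 1
    1*[y*1]≡[y+0]*1 = solve-∀
  am-gm (suc r@(suc _)) x = am-gm-step r (x zero) _ _ (am-gm r (x ∘ suc))

module NatToRational where
  open import Algebra.Bundles using (CommutativeMonoid)
  open import Data.Fin using (Fin; zero; suc)
  open import Data.Integer as ℤ using (ℤ; +_)
  import Data.Integer.Properties as ℤ
  open import Data.Integer.Tactic.RingSolver using (solve-∀)
  open import Data.Nat as ℕ using (ℕ; zero; suc; NonZero)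
  import Data.Nat.Properties as ℕ
  open import Data.Rational using (ℚ; _/_; _+_; _*_; _≤_; 1ℚ; toℚᵘ)
  open import Data.Rational.Properties
  open import Data.Rational.Unnormalised as ℚᵘ using (mkℚᵘ; *≡*; *≤*)
  import Data.Rational.Unnormalised.Properties as ℚᵘ
  open import Function using (_∘_)
  open import Relation.Binary.PropositionalEquality
  open import Algebra.Properties.CommutativeSemigroup (CommutativeMonoid.commutativeSemigroup *-1-commutativeMonoid)
    using (interchange)
  open import Algebra.Properties.Semiring.Sum ℕ.+-*-semiring using (sum-syntax)
  open import Defs using (sumℚ; recipℕ; _^ℚ_)

  fromℕ : ℕ → ℚ
  fromℕ a = + a / 1

  toℚᵘ-/ : ∀ i d → toℚᵘ (i / suc d) ℚᵘ.≃ mkℚᵘ i d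
  toℚᵘ-/ i d = toℚᵘ-fromℚᵘ (mkℚᵘ i d)

  ≡-by-cross-multiplication : ∀ {p q} i j d e → toℚᵘ p ℚᵘ.≃ mkℚᵘ i d → toℚᵘ q ℚᵘ.≃ mkℚᵘ j e →
    i ℤ.* + suc e ≡ j ℤ.* + suc d → p ≡ q
  ≡-by-cross-multiplication i j d e p≃ q≃ eq =
    toℚᵘ-injective (ℚᵘ.≃-trans p≃ (ℚᵘ.≃-trans (*≡* eq) (ℚᵘ.≃-sym q≃)))

  fromℕ-+ : ∀ a b → fromℕ a + fromℕ b ≡ fromℕ (a ℕ.+ b)
  fromℕ-+ a b = ≡-by-cross-multiplication _ (+ (a ℕ.+ b)) 0 0
    (ℚᵘ.≃-trans (toℚᵘ-homo-+ (fromℕ a) (fromℕ b)) (ℚᵘ.+-cong (toℚᵘ-/ (+ a) 0) (toℚᵘ-/ (+ b) 0)))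
    (toℚᵘ-/ _ 0)
    (trans (regroup (+ a) (+ b)) (cong (ℤ._* + 1) (sym (ℤ.pos-+ a b))))
    where
    regroup : ∀ x y → (x ℤ.* + 1 ℤ.+ y ℤ.* + 1) ℤ.* + 1 ≡ (x ℤ.+ y) ℤ.* (+ 1 ℤ.* + 1)
    regroup = solve-∀

  fromℕ-* : ∀ a b → fromℕ a * fromℕ b ≡ fromℕ (a ℕ.* b)
  fromℕ-* a b = ≡-by-cross-multiplication _ (+ (a ℕ.* b)) 0 0
    (ℚᵘ.≃-trans (toℚᵘ-homo-* (fromℕ a) (fromℕ b)) (ℚᵘ.*-cong (toℚᵘ-/ (+ a) 0) (toℚᵘ-/ (+ b) 0)))
    (toℚᵘ-/ _ 0)
    (cong (ℤ._* + 1) (sym (ℤ.pos-* a b)))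

  fromℕ-mono-≤ : ∀ {a b} → a ℕ.≤ b → fromℕ a ≤ fromℕ b
  fromℕ-mono-≤ {a} {b} a≤b = toℚᵘ-cancel-≤
    (ℚᵘ.≤-respˡ-≃ (ℚᵘ.≃-sym (toℚᵘ-/ (+ a) 0)) (ℚᵘ.≤-respʳ-≃ (ℚᵘ.≃-sym (toℚᵘ-/ (+ b) 0))
      (*≤* (ℤ.*-monoʳ-≤-nonNeg (+ 1) (ℤ.+≤+ a≤b)))))

  fromℕ-cancelˡ-≤ : ∀ d .{{_ : NonZero d}} {p q} → fromℕ d * p ≤ fromℕ d * q → p ≤ q
  fromℕ-cancelˡ-≤ (suc d) = *-cancelˡ-≤-pos (fromℕ (suc d)) {{normalize-pos (suc d) 1}}

  fromℕ-*-recipℕ : ∀ v w d → v ℕ.* w ≡ d → .{{NonZero w}} → fromℕ d * recipℕ w ≡ fromℕ v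
  fromℕ-*-recipℕ v (suc w) d v*w≡d = ≡-by-cross-multiplication _ (+ v) _ 0
    (ℚᵘ.≃-trans (toℚᵘ-homo-* (fromℕ d) (+ 1 / suc w)) (ℚᵘ.*-cong (toℚᵘ-/ (+ d) 0) (toℚᵘ-/ (+ 1) w)))
    (toℚᵘ-/ (+ v) 0)
    (begin
      + d ℤ.* + 1 ℤ.* + 1                ≡⟨ cong (λ x → + x ℤ.* + 1 ℤ.* + 1) (sym v*w≡d) ⟩
      + (v ℕ.* suc w) ℤ.* + 1 ℤ.* + 1    ≡⟨ cong (λ x → x ℤ.* + 1 ℤ.* + 1) (ℤ.pos-* v (suc w)) ⟩
      + v ℤ.* + suc w ℤ.* + 1 ℤ.* + 1    ≡⟨ regroup (+ v) (+ suc w) ⟩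
      + v ℤ.* + suc w                    ≡⟨ cong (λ x → + v ℤ.* + suc x) (sym (ℕ.+-identityʳ w)) ⟩
      + v ℤ.* + suc (w ℕ.+ 0)            ∎)
    where
    open ≡-Reasoning
    regroup : ∀ (x y : ℤ) → x ℤ.* y ℤ.* + 1 ℤ.* + 1 ≡ x ℤ.* y
    regroup = solve-∀

  fromℕ-*-sumℚ : ∀ {m} (v w : Fin m → ℕ) d → (∀ i → NonZero (w i)) → (∀ i → v i ℕ.* w i ≡ d) →
    fromℕ d * sumℚ (λ i → recipℕ (w i)) ≡ fromℕ (∑[ i < m ] v i)
  fromℕ-*-sumℚ {zero} v w d _ _ = *-zeroʳ (fromℕ d)
  fromℕ-*-sumℚ {suc m} v w d w≢0 v*w≡d = begin
    fromℕ d * (recipℕ (w zero) + sumℚ (recipℕ ∘ w ∘ suc))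
      ≡⟨ *-distribˡ-+ (fromℕ d) _ _ ⟩
    fromℕ d * recipℕ (w zero) + fromℕ d * sumℚ (recipℕ ∘ w ∘ suc)
      ≡⟨ cong₂ _+_ (fromℕ-*-recipℕ (v zero) (w zero) d (v*w≡d zero) {{w≢0 zero}})
                   (fromℕ-*-sumℚ (v ∘ suc) (w ∘ suc) d (w≢0 ∘ suc) (v*w≡d ∘ suc)) ⟩
    fromℕ (v zero) + fromℕ (∑[ i < m ] v (suc i))
      ≡⟨ fromℕ-+ (v zero) _ ⟩
    fromℕ (∑[ i < suc m ] v i) ∎
    where open ≡-Reasoning

  1+n/r≡[r+n]/r : ∀ n r .{{_ : NonZero r}} → 1ℚ + + n / r ≡ + (r ℕ.+ n) / r
  1+n/r≡[r+n]/r n (suc r) = ≡-by-cross-multiplication _ (+ (suc r ℕ.+ n)) _ r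
    (ℚᵘ.≃-trans (toℚᵘ-homo-+ 1ℚ (+ n / suc r)) (ℚᵘ.+-cong (toℚᵘ-/ (+ 1) 0) (toℚᵘ-/ (+ n) r)))
    (toℚᵘ-/ _ r)
    (trans (regroup (+ suc r) (+ n))
      (cong₂ (λ x y → x ℤ.* + suc y) (sym (ℤ.pos-+ (suc r) n)) (sym (ℕ.+-identityʳ r))))
    where
    regroup : ∀ r n → (+ 1 ℤ.* r ℤ.+ n ℤ.* + 1) ℤ.* r ≡ (r ℤ.+ n) ℤ.* r
    regroup = solve-∀

  fromℕ-*-/ : ∀ a r .{{_ : NonZero r}} → fromℕ r * (+ a / r) ≡ fromℕ a
  fromℕ-*-/ a (suc r) = ≡-by-cross-multiplication _ (+ a) _ 0
    (ℚᵘ.≃-trans (toℚᵘ-homo-* (fromℕ (suc r)) (+ a / suc r)) (ℚᵘ.*-cong (toℚᵘ-/ (+ suc r) 0) (toℚᵘ-/ (+ a) r)))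
    (toℚᵘ-/ (+ a) 0)
    (trans (regroup (+ suc r) (+ a)) (cong (λ x → + a ℤ.* + suc x) (sym (ℕ.+-identityʳ r))))
    where
    regroup : ∀ r a → r ℤ.* a ℤ.* + 1 ≡ a ℤ.* r
    regroup = solve-∀

  fromℕ-^-/ : ∀ a r .{{_ : NonZero r}} j → fromℕ (r ℕ.^ j) * (+ a / r) ^ℚ j ≡ fromℕ (a ℕ.^ j)
  fromℕ-^-/ a r zero = *-identityˡ 1ℚ
  fromℕ-^-/ a r (suc j) = begin
    fromℕ (r ℕ.* r ℕ.^ j) * (a/r * a/r ^ℚ j)          ≡⟨ cong (_* (a/r * a/r ^ℚ j)) (sym (fromℕ-* r (r ℕ.^ j))) ⟩
    fromℕ r * fromℕ (r ℕ.^ j) * (a/r * a/r ^ℚ j)      ≡⟨ interchange (fromℕ r) (fromℕ (r ℕ.^ j)) a/r (a/r ^ℚ j) ⟩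
    fromℕ r * a/r * (fromℕ (r ℕ.^ j) * a/r ^ℚ j)      ≡⟨ cong₂ _*_ (fromℕ-*-/ a r) (fromℕ-^-/ a r j) ⟩
    fromℕ a * fromℕ (a ℕ.^ j)                         ≡⟨ fromℕ-* a (a ℕ.^ j) ⟩
    fromℕ (a ℕ.^ suc j)                               ∎
    where
    open ≡-Reasoning
    a/r = + a / r

open import Data.Bool using (Bool; true; false; _∧_)
open import Data.Empty using (⊥; ⊥-elim)
open import Data.Fin as Fin using (Fin; zero; suc)
open import Data.Nat as ℕ using (ℕ; zero; suc; NonZero; _!)
open import Data.Product using (∃; _×_; _,_; proj₁; proj₂)
open import Function using (_∘_)
open import Relation.Binary.PropositionalEquality
open import Defs
open Counting
open LinearOrders
open Products
open AmGm
open NatToRational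

module SkewFamily
  {n r m : ℕ}
  (X : Fin r → Fin n → Bool)
  (X-disjoint : ∀ {k l y} → X k y ≡ true → X l y ≡ true → k ≡ l)
  (X-cover : ∀ y → ∃ λ k → X k y ≡ true)
  (A B : Fin m → Fin n → Bool)
  (A-B-disjoint : ∀ {i y} → A i y ≡ true → B i y ≡ true → ⊥)
  where
  open import Data.Bool using (not)
  open import Data.Bool.Properties using (∧-assoc; ∧-identityʳ; ∧-zeroʳ; ¬-not)
  import Data.Bool as Bool
  import Data.Fin.Properties as Finₚ
  open import Data.Nat using (_+_; _*_; _∸_; _≤_; _<_; z≤n; s≤s; _≡ᵇ_)
  open import Data.Nat.Properties
  open import Data.Nat.Tactic.RingSolver using (solve-∀)
  open import Data.Vec.Functional using (updateAt)
  open import Induction.WellFounded using (Acc; acc)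
  open import Relation.Binary.Definitions using (tri<; tri≈; tri>)
  open import Relation.Nullary using (yes; no)
  open import Algebra.Properties.Semiring.Sum +-*-semiring
    using (sum; sum-syntax; sum-cong-≗; ∑-distrib-+; *-distribˡ-sum; *-distribʳ-sum)

  inBlock : (Fin n → Bool) → Fin r → Fin n → Bool
  inBlock L k y = X k y ∧ L y

  countIn : (Fin n → Bool) → Fin r → (Fin n → Bool) → ℕ
  countIn L k P = count (λ y → P y ∧ inBlock L k y)

  size : (Fin n → Bool) → Fin r → ℕ
  size L k = countIn L k (λ _ → true)

  factor : (Fin n → Bool) → Fin m → Fin r → ℕ
  factor L i k = orders (size L k) (countIn L k (A i)) (countIn L k (B i))

  pairOrders : (Fin n → Bool) → Fin m → ℕ
  pairOrders L i = prodℕ (factor L i)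

  markedOrders : (Fin n → Bool) → ℕ
  markedOrders L = prodℕ (λ k → suc (size L k) !)

  pairOthers : (Fin n → Bool) → Fin m → Fin r → ℕ
  pairOthers L i k = prodℕ (updateAt (factor L i) k (λ _ → 1))

  markedOthers : (Fin n → Bool) → Fin r → ℕ
  markedOthers L k = prodℕ (updateAt (λ l → suc (size L l) !) k (λ _ → 1))

  AgreeOff : Fin r → (Fin n → Bool) → (Fin n → Bool) → Set
  AgreeOff k L L′ = ∀ y → X k y ≡ false → L′ y ≡ L y

  countIn-agreeOff : ∀ {k L L′} → AgreeOff k L L′ → ∀ l → l ≢ k → ∀ P → countIn L′ l P ≡ countIn L l P
  countIn-agreeOff {k} {L} {L′} agree l l≢k P = count-cong pointwise
    where
    pointwise : ∀ y → (P y ∧ inBlock L′ l y) ≡ (P y ∧ inBlock L l y)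
    pointwise y with X l y in Xly | X k y in Xky
    ... | false | _ = refl
    ... | true | true with () ← l≢k (X-disjoint Xly Xky)
    ... | true | false = cong (P y ∧_) (agree y Xky)

  pairOrders-agreeOff : ∀ {k L L′} → AgreeOff k L L′ → ∀ i → pairOrders L′ i ≡ factor L′ i k * pairOthers L i k
  pairOrders-agreeOff {k} agree i = prodℕ-agreeOff (factor _ i) (factor _ i) k (λ l l≢k →
    cong₃ orders (countIn-agreeOff agree l l≢k (λ _ → true))
                 (countIn-agreeOff agree l l≢k (A i)) (countIn-agreeOff agree l l≢k (B i)))

  markedOrders-agreeOff : ∀ {k L L′} → AgreeOff k L L′ → markedOrders L′ ≡ suc (size L′ k) ! * markedOthers L k
  markedOrders-agreeOff {k} agree = prodℕ-agreeOff _ _ k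
    (λ l l≢k → cong (λ s → suc s !) (countIn-agreeOff agree l l≢k (λ _ → true)))

  dropBlock : (Fin n → Bool) → Fin r → Fin n → Bool
  dropBlock L k y = L y ∧ not (X k y)

  without-agreeOff : ∀ {k L y} → X k y ≡ true → AgreeOff k L (L without y)
  without-agreeOff {k} {L} {y} Xky z Xkz with z Fin.≟ y
  ... | yes refl with () ← trans (sym Xky) Xkz
  ... | no _ = ∧-identityʳ (L z)

  dropBlock-agreeOff : ∀ {k L} → AgreeOff k L (dropBlock L k)
  dropBlock-agreeOff {k} {L} z Xkz = trans (cong (λ b → L z ∧ not b) Xkz) (∧-identityʳ (L z))

  countIn-without : ∀ {k L y} → X k y ≡ true → L y ≡ true → ∀ P →
    countIn L k P ≡ χ (P y) + countIn (L without y) k P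
  countIn-without {k} {L} {y} Xky Ly P = trans (count-remove (λ z → P z ∧ inBlock L k z) y)
    (cong₂ _+_ (cong χ (trans (cong₂ (λ b c → P y ∧ b ∧ c) Xky Ly) (∧-identityʳ (P y))))
               (count-cong (λ z → ∧-assoc₃ (P z) (X k z) (L z) _)))
    where
    ∧-assoc₃ : ∀ a b c d → (a ∧ b ∧ c) ∧ d ≡ a ∧ b ∧ (c ∧ d)
    ∧-assoc₃ a b c d = trans (∧-assoc a (b ∧ c) d) (cong (a ∧_) (∧-assoc b c d))

  countIn-without-∸ : ∀ {k L y} → X k y ≡ true → L y ≡ true → ∀ P →
    countIn (L without y) k P ≡ countIn L k P ∸ χ (P y)
  countIn-without-∸ {k} {L} {y} Xky Ly P = sym (trans (cong (_∸ χ (P y)) (countIn-without Xky Ly P))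
                                                       (m+n∸m≡n (χ (P y)) (countIn (L without y) k P)))

  countIn-dropBlock : ∀ L k P → countIn (dropBlock L k) k P ≡ 0
  countIn-dropBlock L k P = count-none _ pointwise
    where
    pointwise : ∀ y → (P y ∧ X k y ∧ (L y ∧ not (X k y))) ≡ false
    pointwise y with X k y
    ... | true = trans (cong (P y ∧_) (∧-zeroʳ (L y))) (∧-zeroʳ (P y))
    ... | false = ∧-zeroʳ (P y)

  count-dropBlock<count : ∀ {k L y} → X k y ≡ true → L y ≡ true → count (dropBlock L k) < count L
  count-dropBlock<count {k} {L} {y} Xky Ly =
    ≤-<-trans (count-mono dropBlock⊆without) (subst (count (L without y) <_) (sym (count-member L Ly)) ≤-refl)
    where
    dropBlock⊆without : ∀ z → dropBlock L k z ≡ true → (L without y) z ≡ true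
    dropBlock⊆without z drop-z with Lz , not-Xkz ← ∧-true drop-z with z Fin.≟ y
    ... | yes refl with () ← trans (sym not-Xkz) (cong not Xky)
    ... | no _ = trans (∧-identityʳ (L z)) Lz

  B-outside-A : ∀ {i y} → A i y ≡ true → B i y ≡ false
  B-outside-A Aiy = ¬-not (A-B-disjoint Aiy)

  countIn-rest : ∀ L k i →
    count (λ y → inBlock L k y ∧ not (A i y) ∧ not (B i y)) ≡ size L k ∸ countIn L k (A i) ∸ countIn L k (B i)
  countIn-rest L k i = sym (begin
    size L k ∸ a ∸ b          ≡⟨ ∸-+-assoc (size L k) a b ⟩
    size L k ∸ (a + b)        ≡⟨ cong (_∸ (a + b)) (count-classes (inBlock L k) (A i) (B i) (λ _ _ → B-outside-A)) ⟩
    a + b + rest ∸ (a + b)    ≡⟨ m+n∸m≡n (a + b) rest ⟩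
    rest                      ∎)
    where
    open ≡-Reasoning
    a = countIn L k (A i)
    b = countIn L k (B i)
    rest = count (λ y → inBlock L k y ∧ not (A i y) ∧ not (B i y))

  countIn-A+B≤size : ∀ L k i → countIn L k (A i) + countIn L k (B i) ≤ size L k
  countIn-A+B≤size L k i =
    ≤-trans (m≤m+n _ _) (≤-reflexive (sym (count-classes (inBlock L k) (A i) (B i) (λ _ _ → B-outside-A))))

  factor-without : ∀ {k L y} → X k y ≡ true → L y ≡ true → ∀ i →
    factor (L without y) i k ≡ orders (size L k ∸ 1) (countIn L k (A i) ∸ χ (A i y)) (countIn L k (B i) ∸ χ (B i y))
  factor-without Xky Ly i = cong₃ orders (countIn-without-∸ Xky Ly (λ _ → true))
                                         (countIn-without-∸ Xky Ly (A i)) (countIn-without-∸ Xky Ly (B i))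

  factor-dropBlock : ∀ L k i → factor (dropBlock L k) i k ≡ 1
  factor-dropBlock L k i =
    cong₃ orders (countIn-dropBlock L k (λ _ → true)) (countIn-dropBlock L k (A i)) (countIn-dropBlock L k (B i))

  keeps : Fin m → Fin n → Bool
  keeps i y = not (A i y)

  cuts : (Fin n → Bool) → Fin r → Fin m → Fin n → Bool
  cuts L k i y = A i y ∧ (countIn L k (B i) ≡ᵇ 0)

  survives : (Fin n → Bool) → Fin r → Fin m → Fin n → ℕ
  survives L k i y = χ (keeps i y) + χ (cuts L k i y)

  -- Summing over the last element y of the block: the pair survives unless y ∈ A i
  -- while B i still meets the block.
  factor-recurrence : ∀ {k L x} → X k x ≡ true → L x ≡ true → ∀ i →
    ∑[ y < n ] (χ (inBlock L k y) * (survives L k i y * factor (L without y) i k)) ≡ factor L i k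
  factor-recurrence {k} {L} Xkx Lx i = begin
    ∑[ y < n ] (χ (inBlock L k y) * (survives L k i y * factor (L without y) i k))
      ≡⟨ sum-cong-≗ pointwise ⟩
    ∑[ y < n ] (χ (inBlock L k y) * g (A i y) (B i y))
      ≡⟨ ∑-χ-classes (inBlock L k) (A i) (B i) (λ _ _ → B-outside-A) g ⟩
    a * g true false + b * g false true + count (λ y → inBlock L k y ∧ not (A i y) ∧ not (B i y)) * g false false
      ≡⟨ cong₂ _+_ (cong (λ t → a * g true false + b * t) (*-identityˡ _))
                   (cong₂ _*_ (countIn-rest L k i) (*-identityˡ _)) ⟩
    a * (χ (b ≡ᵇ 0) * orders (s ∸ 1) (a ∸ 1) b) + b * orders (s ∸ 1) a (b ∸ 1) + (s ∸ a ∸ b) * orders (s ∸ 1) a b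
      ≡⟨ sym (orders-unfold 0<s a b) ⟩
    factor L i k ∎
    where
    open ≡-Reasoning
    s = size L k
    a = countIn L k (A i)
    b = countIn L k (B i)
    0<s : 0 < s
    0<s = subst (0 <_) (sym (countIn-without Xkx Lx (λ _ → true))) (s≤s z≤n)
    g : Bool → Bool → ℕ
    g p q = (χ (not p) + χ (p ∧ (b ≡ᵇ 0))) * orders (s ∸ 1) (a ∸ χ p) (b ∸ χ q)
    pointwise : ∀ y → χ (inBlock L k y) * (survives L k i y * factor (L without y) i k)
                    ≡ χ (inBlock L k y) * g (A i y) (B i y)
    pointwise y with X k y in Xky | L y in Ly
    ... | true | true = cong (λ t → 1 * (survives L k i y * t)) (factor-without Xky Ly i)
    ... | true | false = refl
    ... | false | _ = refl

  pairOrders-recurrence : ∀ {k L x} → X k x ≡ true → L x ≡ true → ∀ i →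
    ∑[ y < n ] (χ (inBlock L k y) * (survives L k i y * pairOrders (L without y) i)) ≡ pairOrders L i
  pairOrders-recurrence {k} {L} Xkx Lx i = begin
    ∑[ y < n ] (χ (inBlock L k y) * (survives L k i y * pairOrders (L without y) i))
      ≡⟨ sum-cong-≗ pointwise ⟩
    ∑[ y < n ] (term y * pairOthers L i k)
      ≡⟨ sym (*-distribʳ-sum (pairOthers L i k) term) ⟩
    ∑[ y < n ] term y * pairOthers L i k
      ≡⟨ cong (_* pairOthers L i k) (factor-recurrence Xkx Lx i) ⟩
    factor L i k * pairOthers L i k
      ≡⟨ sym (pairOrders-agreeOff (λ _ _ → refl) i) ⟩
    pairOrders L i ∎
    where
    open ≡-Reasoning
    term = λ y → χ (inBlock L k y) * (survives L k i y * factor (L without y) i k)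
    pointwise : ∀ y → χ (inBlock L k y) * (survives L k i y * pairOrders (L without y) i) ≡ term y * pairOthers L i k
    pointwise y with X k y in Xky | L y in Ly
    ... | true | true = trans (cong (λ t → 1 * (survives L k i y * t)) (pairOrders-agreeOff (without-agreeOff Xky) i))
                              (reassoc (survives L k i y) (factor (L without y) i k) (pairOthers L i k))
      where
      reassoc : ∀ c f o → 1 * (c * (f * o)) ≡ 1 * (c * f) * o
      reassoc = solve-∀
    ... | true | false = refl
    ... | false | _ = refl

  pairOrders-cut : ∀ {k L y} → X k y ≡ true → L y ≡ true → ∀ {i} → cuts L k i y ≡ true →
    pairOrders (L without y) i ≡ (size L k ∸ 1) ! * pairOrders (dropBlock L k) i
  pairOrders-cut {k} {L} {y} Xky Ly {i} cut with Aiy , b≡ᵇ0 ← ∧-true cut = begin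
    pairOrders (L without y) i
      ≡⟨ pairOrders-agreeOff (without-agreeOff Xky) i ⟩
    factor (L without y) i k * o
      ≡⟨ cong (_* o) (factor-without Xky Ly i) ⟩
    orders (s ∸ 1) (a ∸ χ (A i y)) (b ∸ χ (B i y)) * o
      ≡⟨ cong (λ t → orders (s ∸ 1) (a ∸ χ (A i y)) t * o)
              (trans (cong (λ c → b ∸ χ c) (B-outside-A Aiy)) (≡ᵇ0⇒≡0 b≡ᵇ0)) ⟩
    orders (s ∸ 1) (a ∸ χ (A i y)) 0 * o
      ≡⟨ cong (_* o) (orders[s,a,0]≡s! (s ∸ 1) _ (∸-mono a≤s (≤-reflexive (cong χ (sym Aiy))))) ⟩
    (s ∸ 1) ! * o
      ≡⟨ cong ((s ∸ 1) ! *_) (sym (trans (cong (_* o) (factor-dropBlock L k i)) (*-identityˡ o))) ⟩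
    (s ∸ 1) ! * (factor (dropBlock L k) i k * o)
      ≡⟨ cong ((s ∸ 1) ! *_) (sym (pairOrders-agreeOff dropBlock-agreeOff i)) ⟩
    (s ∸ 1) ! * pairOrders (dropBlock L k) i ∎
    where
    open ≡-Reasoning
    s = size L k
    a = countIn L k (A i)
    b = countIn L k (B i)
    o = pairOthers L i k
    a≤s : a ≤ s
    a≤s = ≤-trans (m≤m+n a b) (countIn-A+B≤size L k i)

  Meets : (Fin n → Bool) → (Fin m → Bool) → Set
  Meets L I = ∀ {i j} → I i ≡ true → I j ≡ true → i Fin.< j →
    ∃ λ y → L y ≡ true × A i y ≡ true × B j y ≡ true

  meets-without : ∀ {L I} y → Meets L I → Meets (L without y) (λ i → I i ∧ keeps i y)
  meets-without {L} y meets Ii Ij i<j with Ii , keeps-i ← ∧-true Ii | Ij , _ ← ∧-true Ij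
    with z , Lz , Aiz , Bjz ← meets Ii Ij i<j = z , without-z , Aiz , Bjz
    where
    without-z : (L without y) z ≡ true
    without-z with z Fin.≟ y
    ... | yes refl with () ← trans (sym keeps-i) (cong not Aiz)
    ... | no _ = trans (∧-identityʳ (L z)) Lz

  meets-dropBlock : ∀ {L I} k y → Meets L I → Meets (dropBlock L k) (λ i → I i ∧ cuts L k i y)
  meets-dropBlock {L} k y meets {j = j} Ii Ij i<j with Ii , _ ← ∧-true Ii | Ij , cuts-j ← ∧-true Ij
    with z , Lz , Aiz , Bjz ← meets Ii Ij i<j = z , dropBlock-z , Aiz , Bjz
    where
    dropBlock-z : dropBlock L k z ≡ true
    dropBlock-z with X k z in Xkz
    ... | false = trans (∧-identityʳ (L z)) Lz
    ... | true with () ← count≡0⇒∉ (λ y → B j y ∧ inBlock L k y) (≡ᵇ0⇒≡0 (proj₂ (∧-true cuts-j)))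
                                   (trans (cong₂ (λ b c → b ∧ c ∧ L z) Bjz Xkz) Lz)

  total : (Fin n → Bool) → (Fin m → Bool) → ℕ
  total L I = ∑[ i < m ] (χ (I i) * pairOrders L i)

  TotalBound : (Fin n → Bool) → Set
  TotalBound L = ∀ I → Meets L I → total L I ≤ markedOrders L

  -- Pairs with y ∉ A i stay skew on L - y; pairs cut by y have B i ∩ X k ∩ L = ∅ and
  -- stay skew once the whole block is removed.
  survivors-bound : ∀ {k L y} → X k y ≡ true → L y ≡ true → (∀ L′ → count L′ < count L → TotalBound L′) →
    ∀ I → Meets L I →
    ∑[ i < m ] (χ (I i) * (survives L k i y * pairOrders (L without y) i))
      ≤ size L k ! * markedOthers L k + (size L k ∸ 1) ! * markedOthers L k
  survivors-bound {k} {L} {y} Xky Ly IH I meets = begin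
    ∑[ i < m ] (χ (I i) * (survives L k i y * pairOrders (L without y) i))
      ≡⟨ trans (sum-cong-≗ (λ i → χ-split (I i) (keeps i y) (cuts L k i y) (pairOrders (L without y) i)))
               (∑-distrib-+ (λ i → χ (I-keeps i) * pairOrders (L without y) i) cut-terms) ⟩
    total (L without y) I-keeps + sum cut-terms
      ≡⟨ cong (total (L without y) I-keeps +_) cut-part ⟩
    total (L without y) I-keeps + (s ∸ 1) ! * total (dropBlock L k) I-cuts
      ≤⟨ +-mono-≤ (IH _ (subst (count (L without y) <_) (sym (count-member L Ly)) ≤-refl)
                     I-keeps (meets-without y meets))
                  (*-monoʳ-≤ ((s ∸ 1) !) (IH _ (count-dropBlock<count Xky Ly) I-cuts (meets-dropBlock k y meets))) ⟩
    markedOrders (L without y) + (s ∸ 1) ! * markedOrders (dropBlock L k)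
      ≡⟨ cong₂ (λ u v → u + (s ∸ 1) ! * v) marked-without marked-dropBlock ⟩
    s ! * markedOthers L k + (s ∸ 1) ! * markedOthers L k ∎
    where
    open ≤-Reasoning
    s = size L k
    I-keeps = λ i → I i ∧ keeps i y
    I-cuts = λ i → I i ∧ cuts L k i y
    cut-terms = λ i → χ (I-cuts i) * pairOrders (L without y) i
    χ-split : ∀ a b c v → χ a * ((χ b + χ c) * v) ≡ χ (a ∧ b) * v + χ (a ∧ c) * v
    χ-split a b c v rewrite χ-∧ a b | χ-∧ a c = distrib (χ a) (χ b) (χ c) v
      where
      distrib : ∀ a b c v → a * ((b + c) * v) ≡ a * b * v + a * c * v
      distrib = solve-∀
    cut-part : sum cut-terms ≡ (s ∸ 1) ! * total (dropBlock L k) I-cuts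
    cut-part = trans (sum-cong-≗ pointwise)
      (sym (*-distribˡ-sum ((s ∸ 1) !) (λ i → χ (I-cuts i) * pairOrders (dropBlock L k) i)))
      where
      pointwise : ∀ i → cut-terms i ≡ (s ∸ 1) ! * (χ (I-cuts i) * pairOrders (dropBlock L k) i)
      pointwise i with I-cuts i in cut
      ... | false = sym (*-zeroʳ ((s ∸ 1) !))
      ... | true = trans (*-identityˡ _) (trans (pairOrders-cut Xky Ly (proj₂ (∧-true {I i} cut)))
                                                (cong ((s ∸ 1) ! *_) (sym (*-identityˡ _))))
    marked-without : markedOrders (L without y) ≡ s ! * markedOthers L k
    marked-without = trans (markedOrders-agreeOff (without-agreeOff Xky))
      (cong (λ t → t ! * markedOthers L k) (sym (countIn-without Xky Ly (λ _ → true))))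
    marked-dropBlock : markedOrders (dropBlock L k) ≡ markedOthers L k
    marked-dropBlock = trans (markedOrders-agreeOff dropBlock-agreeOff)
      (trans (cong (λ t → suc t ! * markedOthers L k) (countIn-dropBlock L k (λ _ → true))) (*-identityˡ _))

  total-step : ∀ {k L x} → X k x ≡ true → L x ≡ true → (∀ L′ → count L′ < count L → TotalBound L′) →
    TotalBound L
  total-step {k} {L} Xkx Lx IH I meets = begin
    total L I
      ≡⟨ sum-cong-≗ (λ i → cong (χ (I i) *_) (sym (pairOrders-recurrence Xkx Lx i))) ⟩
    ∑[ i < m ] (χ (I i) * ∑[ y < n ] (χ (inBlock L k y) * (survives L k i y * pairOrders (L without y) i)))
      ≡⟨ ∑-*-∑-comm (χ ∘ I) (χ ∘ inBlock L k) (λ i y → survives L k i y * pairOrders (L without y) i) ⟩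
    ∑[ y < n ] (χ (inBlock L k y) * ∑[ i < m ] (χ (I i) * (survives L k i y * pairOrders (L without y) i)))
      ≤⟨ sum-mono-≤ bound ⟩
    ∑[ y < n ] (χ (inBlock L k y) * (s ! * o + (s ∸ 1) ! * o))
      ≡⟨ ∑-χ* (inBlock L k) (s ! * o + (s ∸ 1) ! * o) ⟩
    s * (s ! * o + (s ∸ 1) ! * o)
      ≡⟨ factorial-step (subst (0 <_) (sym (countIn-without Xkx Lx (λ _ → true))) (s≤s z≤n)) ⟩
    suc s ! * o
      ≡⟨ sym (markedOrders-agreeOff (λ _ _ → refl)) ⟩
    markedOrders L ∎
    where
    open ≤-Reasoning
    s = size L k
    o = markedOthers L k
    bound : ∀ y → χ (inBlock L k y) * ∑[ i < m ] (χ (I i) * (survives L k i y * pairOrders (L without y) i))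
                ≤ χ (inBlock L k y) * (s ! * o + (s ∸ 1) ! * o)
    bound y with inBlock L k y in Yy
    ... | false = z≤n
    ... | true with Xky , Ly ← ∧-true {X k y} Yy = *-monoʳ-≤ 1 (survivors-bound Xky Ly IH I meets)
    factorial-step : ∀ {s} → 0 < s → s * (s ! * o + (s ∸ 1) ! * o) ≡ suc s ! * o
    factorial-step {suc s} _ = expand s (s !) o
      where
      expand : ∀ s f o → suc s * (suc s * f * o + f * o) ≡ suc (suc s) * (suc s * f) * o
      expand = solve-∀

  total-empty : ∀ {L} → (∀ y → L y ≡ false) → TotalBound L
  total-empty {L} empty I meets = begin
    total L I                  ≡⟨ sum-cong-≗ (λ i → cong (χ (I i) *_) (pairOrders-empty i)) ⟩
    ∑[ i < m ] (χ (I i) * 1)   ≡⟨ ∑-χ* I 1 ⟩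
    count I * 1                ≤⟨ *-monoˡ-≤ 1 (count≤1 I unique) ⟩
    1                          ≡⟨ sym markedOrders-empty ⟩
    markedOrders L             ∎
    where
    open ≤-Reasoning
    countIn-empty : ∀ k P → countIn L k P ≡ 0
    countIn-empty k P = count-none _ (λ y →
      trans (cong (λ b → P y ∧ X k y ∧ b) (empty y)) (trans (cong (P y ∧_) (∧-zeroʳ (X k y))) (∧-zeroʳ (P y))))
    pairOrders-empty : ∀ i → pairOrders L i ≡ 1
    pairOrders-empty i = trans (prodℕ-cong (λ k →
      cong₃ orders (countIn-empty k (λ _ → true)) (countIn-empty k (A i)) (countIn-empty k (B i)))) (prodℕ-1 r)
    markedOrders-empty : markedOrders L ≡ 1
    markedOrders-empty = trans (prodℕ-cong (λ k → cong (λ t → suc t !) (countIn-empty k (λ _ → true)))) (prodℕ-1 r)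
    no-witness : ∀ {i j} → I i ≡ true → I j ≡ true → i Fin.< j → ⊥
    no-witness Ii Ij i<j with z , Lz , _ ← meets Ii Ij i<j with () ← trans (sym (empty z)) Lz
    unique : ∀ i j → I i ≡ true → I j ≡ true → i ≡ j
    unique i j Ii Ij with Finₚ.<-cmp i j
    ... | tri< i<j _ _ with () ← no-witness Ii Ij i<j
    ... | tri≈ _ i≡j _ = i≡j
    ... | tri> _ _ j<i with () ← no-witness Ij Ii j<i

  total≤markedOrders : ∀ L → Acc _<_ (count L) → TotalBound L
  total≤markedOrders L (acc smaller) with Finₚ.any? (λ y → L y Bool.≟ true)
  ... | yes (x , Lx) with k , Xkx ← X-cover x = total-step Xkx Lx (λ L′ lt → total≤markedOrders L′ (smaller lt))
  ... | no ∄x = total-empty (λ y → ¬-not (∄x ∘ (y ,_)))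

open import Data.Bool.Properties using (∧-identityʳ)
open import Data.Fin.Subset using (Subset; _∩_; _∈_; ∣_∣; Empty; inside; outside)
open import Data.Fin.Subset.Properties using (x∈p∩q⁺; x∈p∩q⁻)
open import Data.Integer using (+_)
import Data.Nat.Properties as ℕ
open import Data.Nat.Combinatorics using (_C_)
open import Data.Nat.Induction using (<-wellFounded)
open import Data.Rational using (_≤_; _+_; _/_; 1ℚ; _*_)
import Data.Rational.Properties as ℚ
open import Data.Vec using ([]; _∷_; lookup)
open import Data.Vec.Properties using ([]=⇒lookup; lookup⇒[]=; lookup-zipWith)
open import Relation.Nullary using (yes; no)
open import Algebra.Properties.Semiring.Sum ℕ.+-*-semiring using (sum; sum-syntax; sum-cong-≗; ∑-distrib-+; ∑-comm)

∣p∣≡count : ∀ {n} (p : Subset n) → ∣ p ∣ ≡ count (lookup p)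
∣p∣≡count [] = refl
∣p∣≡count (inside ∷ p) = cong suc (∣p∣≡count p)
∣p∣≡count (outside ∷ p) = ∣p∣≡count p

lookup⇒∈∩ : ∀ {n} {p q : Subset n} {y} → lookup p y ≡ true → lookup q y ≡ true → y ∈ p ∩ q
lookup⇒∈∩ {p = p} {q} {y} py qy = x∈p∩q⁺ (lookup⇒[]= y p py , lookup⇒[]= y q qy)

∑-count≤n : ∀ {n r} (X : Fin r → Fin n → Bool) → (∀ {k l y} → X k y ≡ true → X l y ≡ true → k ≡ l) →
  ∑[ k < r ] count (X k) ℕ.≤ n
∑-count≤n {n} {r} X disjoint = begin
  ∑[ k < r ] ∑[ y < n ] χ (X k y)   ≡⟨ ∑-comm (λ k y → χ (X k y)) ⟩
  ∑[ y < n ] count (λ k → X k y)    ≤⟨ sum-mono-≤ (λ y → count≤1 (λ k → X k y) (λ _ _ → disjoint)) ⟩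
  count {n} (λ _ → true)            ≡⟨ count-all n ⟩
  n                                 ∎
  where open ℕ.≤-Reasoning

prod[1+x]≤[1+n/r]^r : ∀ n r .{{_ : NonZero r}} (x : Fin r → ℕ) → ∑[ k < r ] x k ℕ.≤ n →
  fromℕ (prodℕ (suc ∘ x)) ≤ (1ℚ + + n / r) ^ℚ r
prod[1+x]≤[1+n/r]^r n r x ∑x≤n = fromℕ-cancelˡ-≤ (r ℕ.^ r) {{ℕ.m^n≢0 r r}} (begin
  fromℕ (r ℕ.^ r) * fromℕ (prodℕ (suc ∘ x))
    ≡⟨ fromℕ-* (r ℕ.^ r) _ ⟩
  fromℕ (r ℕ.^ r ℕ.* prodℕ (suc ∘ x))
    ≤⟨ fromℕ-mono-≤ (ℕ.≤-trans (am-gm r (suc ∘ x)) (ℕ.^-monoˡ-≤ r ∑[1+x]≤r+n)) ⟩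
  fromℕ ((r ℕ.+ n) ℕ.^ r)
    ≡⟨ sym (fromℕ-^-/ (r ℕ.+ n) r r) ⟩
  fromℕ (r ℕ.^ r) * (+ (r ℕ.+ n) / r) ^ℚ r
    ≡⟨ cong (λ q → fromℕ (r ℕ.^ r) * q ^ℚ r) (sym (1+n/r≡[r+n]/r n r)) ⟩
  fromℕ (r ℕ.^ r) * (1ℚ + + n / r) ^ℚ r ∎)
  where
  open ℚ.≤-Reasoning
  ∑[1+x]≤r+n : ∑[ k < r ] suc (x k) ℕ.≤ r ℕ.+ n
  ∑[1+x]≤r+n = ℕ.≤-trans (ℕ.≤-reflexive (trans (∑-distrib-+ (λ _ → 1) x) (cong (ℕ._+ sum x) (count-all r))))
                          (ℕ.+-monoʳ-≤ r ∑x≤n)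

module _ {n r} (X : Fin r → Subset n) (X-disjoint : ∀ k l → k ≢ l → Empty (X k ∩ X l)) where

  blocks-disjoint : ∀ {k l y} → lookup (X k) y ≡ true → lookup (X l) y ≡ true → k ≡ l
  blocks-disjoint {k} {l} {y} Xky Xly with k Fin.≟ l
  ... | yes k≡l = k≡l
  ... | no k≢l = ⊥-elim (X-disjoint k l k≢l (y , lookup⇒∈∩ Xky Xly))

  ∑∣X∣≤n : ∑[ k < r ] ∣ X k ∣ ℕ.≤ n
  ∑∣X∣≤n = subst (ℕ._≤ n) (sum-cong-≗ (sym ∘ ∣p∣≡count ∘ X)) (∑-count≤n (lookup ∘ X) blocks-disjoint)

  module _ {m} (X-cover : ∀ x → ∃ λ k → x ∈ X k) (A B : Fin m → Subset n) (skew : SkewBollobas A B) where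

    open SkewFamily (lookup ∘ X) blocks-disjoint (λ y → proj₁ (X-cover y) , []=⇒lookup (proj₂ (X-cover y)))
      (lookup ∘ A) (lookup ∘ B) (λ {i} Aiy Biy → proj₁ skew i (_ , lookup⇒∈∩ Aiy Biy))

    full : Fin n → Bool
    full _ = true

    countIn-full : ∀ k p → countIn full k (lookup p) ≡ ∣ p ∩ X k ∣
    countIn-full k p = sym (trans (∣p∣≡count (p ∩ X k)) (count-cong (λ y →
      trans (lookup-zipWith _∧_ y p (X k)) (cong (lookup p y ∧_) (sym (∧-identityʳ (lookup (X k) y)))))))

    size-full : ∀ k → size full k ≡ ∣ X k ∣
    size-full k = sym (trans (∣p∣≡count (X k)) (count-cong (λ y → sym (∧-identityʳ (lookup (X k) y)))))

    meets-full : Meets full (λ _ → true)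
    meets-full {i} {j} _ _ i<j with y , y∈A∩B ← proj₂ skew i j i<j
      with y∈A , y∈B ← x∈p∩q⁻ (A i) (B j) y∈A∩B = y , refl , []=⇒lookup y∈A , []=⇒lookup y∈B

    D : ℕ
    D = prodℕ (λ k → ∣ X k ∣ !)

    factor*binomial≡! : ∀ i k → factor full i k ℕ.* ((∣ A i ∩ X k ∣ ℕ.+ ∣ B i ∩ X k ∣) C ∣ A i ∩ X k ∣) ≡ ∣ X k ∣ !
    factor*binomial≡! i k = begin
      factor full i k ℕ.* ((∣ A i ∩ X k ∣ ℕ.+ ∣ B i ∩ X k ∣) C ∣ A i ∩ X k ∣)
        ≡⟨ cong₂ (λ a b → factor full i k ℕ.* ((a ℕ.+ b) C a)) (sym (countIn-full k (A i))) (sym (countIn-full k (B i))) ⟩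
      orders (size full k) a b ℕ.* ((a ℕ.+ b) C a)
        ≡⟨ orders*[a+b]Ca≡s! (size full k) a b (countIn-A+B≤size full k i) ⟩
      size full k !
        ≡⟨ cong _! (size-full k) ⟩
      ∣ X k ∣ ! ∎
      where
      open ≡-Reasoning
      a = countIn full k (lookup (A i))
      b = countIn full k (lookup (B i))

    pairOrders*weight≡D : ∀ i → pairOrders full i ℕ.* weight X (A i) (B i) ≡ D
    pairOrders*weight≡D i = trans (sym (prodℕ-*-distrib (factor full i) _)) (prodℕ-cong (factor*binomial≡! i))

    markedOrders-full : markedOrders full ≡ prodℕ (λ k → suc ∣ X k ∣) ℕ.* D
    markedOrders-full = trans (prodℕ-cong (λ k → cong (λ t → suc t !) (size-full k)))
                              (prodℕ-*-distrib (λ k → suc ∣ X k ∣) (λ k → ∣ X k ∣ !))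

    ∑1/weight≤prod[1+∣X∣] : sumℚ (λ i → recipℕ (weight X (A i) (B i))) ≤ fromℕ (prodℕ (λ k → suc ∣ X k ∣))
    ∑1/weight≤prod[1+∣X∣] = fromℕ-cancelˡ-≤ D {{D≢0}} (begin
      fromℕ D * sumℚ (λ i → recipℕ (weight X (A i) (B i)))
        ≡⟨ fromℕ-*-sumℚ (pairOrders full) _ D weight≢0 pairOrders*weight≡D ⟩
      fromℕ (∑[ i < m ] pairOrders full i)
        ≤⟨ fromℕ-mono-≤ (subst (ℕ._≤ markedOrders full) total-full bound) ⟩
      fromℕ (markedOrders full)
        ≡⟨ cong fromℕ (trans markedOrders-full (ℕ.*-comm _ D)) ⟩
      fromℕ (D ℕ.* P)
        ≡⟨ sym (fromℕ-* D P) ⟩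
      fromℕ D * fromℕ P ∎)
      where
      open ℚ.≤-Reasoning
      P = prodℕ (λ k → suc ∣ X k ∣)
      D≢0 : NonZero D
      D≢0 = prodℕ-nonZero _ (λ k → ℕ._!≢0 ∣ X k ∣)
      weight≢0 : ∀ i → NonZero (weight X (A i) (B i))
      weight≢0 i = ℕ.m*n≢0⇒n≢0 (pairOrders full i) {{subst NonZero (sym (pairOrders*weight≡D i)) D≢0}}
      bound : total full (λ _ → true) ℕ.≤ markedOrders full
      bound = total≤markedOrders full (<-wellFounded _) (λ _ → true) meets-full
      total-full : total full (λ _ → true) ≡ ∑[ i < m ] pairOrders full i
      total-full = sum-cong-≗ (λ i → ℕ.*-identityˡ (pairOrders full i))

theorem1p7 : (n r m : ℕ) → .{{_ : NonZero r}} →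
    (X : Fin r → Subset n) →
    (∀ k l → k ≢ l → Empty (X k ∩ X l)) →
    (∀ x → ∃ λ k → x ∈ X k) →
    (A B : Fin m → Subset n) →
    SkewBollobas A B →
    (sumℚ (λ i → recipℕ (weight X (A i) (B i))) ≤ (+ prodℕ (λ k → suc ∣ X k ∣) / 1))
    × ((+ prodℕ (λ k → suc ∣ X k ∣) / 1) ≤ ((1ℚ + (+ n / r)) ^ℚ r))
theorem1p7 n r m X X-disjoint X-cover A B skew =
  ∑1/weight≤prod[1+∣X∣] X X-disjoint X-cover A B skew ,
  prod[1+x]≤[1+n/r]^r n r (λ k → ∣ X k ∣) (∑∣X∣≤n X X-disjoint)
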